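{- Let $\mathrm{ord}(\ell)>3$, and let $\mathcal{F}$ be the folded component (the graph specified in the context). Suppose the new edge $\mathcal{E}$, which joins two distinct floor vertices, has both endpoints in $\mathcal{F}$, and write $\mathcal{E}=\{2m,2(m+k)\}$ with $m,k\in\mathbb{Z}$, $1\le m\le\frac12(\mathrm{ord}(\ell)-3)$ and $1\le k\le\frac12(\mathrm{ord}(\ell)-1)-m$. Let $\mathcal{F}+\mathcal{E}$ be the graph obtained from $\mathcal{F}$ by adding the edge $\mathcal{E}$. Then the value of $\mathrm{diam}(\mathcal{F}+\mathcal{E})$ is: 1. $\max\left[\frac12(\mathrm{ord}(\ell)-2k+7),\ \left\lceil\frac k2\right\rceil+\frac12(\mathrm{ord}(\ell)-2(m+k)+5),\ m+\left\lceil\frac k2\right\rceil+2\right]$ if $k\ge4$; 2. $\frac12(\mathrm{ord}(\ell)-1)$ if $k\in\{2,3\}$ and $2(m+k)=\mathrm{ord}(\ell)-1$; 3. $\frac12(\mathrm{ord}(\ell)+1)$ otherwise.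
   Context: Let $p$ be a prime with $p\equiv 71$ or $119\pmod{120}$, let $\ell=2$, and let $\mathrm{ord}(\ell)$ be the order, in the ideal class group of $\mathbb{Q}(\sqrt{ -p})$, of a prime ideal above $2$; it is an odd integer $\ge 3$. The folded component $\mathcal{F}$ (a component of the supersingular $2$-isogeny graph over $\mathbb{F}_p$ after identifying curves up to $\overline{\mathbb{F}_p}$-isomorphism, regarded as a simple undirected graph) is labelled so that $V(\mathcal{F})=\{0,1,\dots,\mathrm{ord}(\ell)-1\}$ and $$E(\mathcal{F})=\{\{2k-1,2k+1\}: 1\le k\le \tfrac12(\mathrm{ord}(\ell)-3)\}\cup\{\{2k+1,2k+2\}:0\le k\le \tfrac12(\mathrm{ord}(\ell)-3)\}\cup\{\{0,1\}\}.$$ The floor vertices of $\mathcal{F}$ are the nonzero even vertices. The new edge $\mathcal{E}$ is the single edge coming from $2$-isogenies not defined over $\mathbb{F}_p$ that must be added to obtain the spine; its endpoints are always two distinct floor vertices, and here it is treated as an arbitrary edge joining two distinct floor vertices of $\mathcal{F}$. The diameter is the maximum graph distance between two vertices. -}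

module Defs where

open import Data.Fin using (Fin; toℕ)
open import Data.Nat using (ℕ; zero; suc; _+_; _*_; _∸_; _≤_; _<_)
open import Data.Nat.Divisibility using (_∣_)
open import Data.Nat.DivMod using (_/_)
open import Data.Nat.Properties using (<⇒≢; ≤-<-trans; n<1+n; m∸n≤m; m<m+n; +-monoʳ-<; 0<1+n)
open import Data.Product using (_×_; _,_; ∃-syntax)
open import Data.Sum using (_⊎_; inj₁; inj₂)
open import Function using (_on_; _∘_)
open import Relation.Binary.Core using (Rel)
open import Relation.Binary.Definitions using (Symmetric)
open import Relation.Binary.Construct.Closure.Symmetric using (SymClosure; fwd; bwd; symmetric)
open import Relation.Binary.PropositionalEquality using (_≡_; _≢_; refl; sym; cong)
open import Level using (0ℓ)

record SimpleGraph : Set₁ where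
  field
    Vertex : Set
    _~_    : Rel Vertex 0ℓ
    ~-sym  : Symmetric _~_
    ~-irr  : ∀ {u v} → u ~ v → u ≢ v

open SimpleGraph public using (Vertex)

infixr 5 _∷_

data Walk (G : SimpleGraph) : ℕ → Rel (Vertex G) 0ℓ where
  []  : ∀ {u} → Walk G zero u u
  _∷_ : ∀ {n u v w} → SimpleGraph._~_ G u v → Walk G n v w → Walk G (suc n) u w

IsDistance : (G : SimpleGraph) → Vertex G → Vertex G → ℕ → Set
IsDistance G u v d = Walk G d u v × (∀ {e} → Walk G e u v → d ≤ e)

-- A graph has a (finite) diameter in this sense only if it is connected.
IsDiameter : SimpleGraph → ℕ → Set
IsDiameter G D =
  (∀ u v → ∃[ d ] (IsDistance G u v d × d ≤ D)) ×
  (∃[ u ] ∃[ v ] IsDistance G u v D)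

addEdge : (G : SimpleGraph) (x y : Vertex G) → x ≢ y → SimpleGraph
addEdge G x y x≢y = record
  { Vertex = Vertex G
  ; _~_    = λ u v → u ~ v ⊎ SymClosure (λ a b → a ≡ x × b ≡ y) u v
  ; ~-sym  = λ { (inj₁ e) → inj₁ (~-sym e) ; (inj₂ e) → inj₂ (symmetric _ e) }
  ; ~-irr  = λ
      { (inj₁ e)                    → ~-irr e
      ; (inj₂ (fwd (refl , refl))) → x≢y
      ; (inj₂ (bwd (refl , refl))) → x≢y ∘ sym
      }
  }
  where open SimpleGraph G using (_~_; ~-sym; ~-irr)

-- The edges of the folded component, each listed once as an ordered pair.
-- The parameter n stands for ord(ℓ).  For odd n ≥ 3 and within the given
-- ranges, neither subtraction truncates and the division by 2 is exact.
data FoldedEdge (n : ℕ) : Rel ℕ 0ℓ where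
  odd-odd   : ∀ {k} → 1 ≤ k → k ≤ (n ∸ 3) / 2 → FoldedEdge n (2 * k ∸ 1) (2 * k + 1)
  odd-floor : ∀ {k} → k ≤ (n ∸ 3) / 2 → FoldedEdge n (2 * k + 1) (2 * k + 2)
  zero-one  : FoldedEdge n 0 1

FoldedEdge⇒< : ∀ {n a b} → FoldedEdge n a b → a < b
FoldedEdge⇒< (odd-odd {k} _ _) = ≤-<-trans (m∸n≤m (2 * k) 1) (m<m+n (2 * k) 0<1+n)
FoldedEdge⇒< (odd-floor {k} _) = +-monoʳ-< (2 * k) (n<1+n 1)
FoldedEdge⇒< zero-one          = n<1+n 0

folded : ℕ → SimpleGraph
folded n = record
  { Vertex = Fin n
  ; _~_    = SymClosure (FoldedEdge n on toℕ)
  ; ~-sym  = symmetric _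
  ; ~-irr  = λ
      { (fwd e) → <⇒≢ (FoldedEdge⇒< e) ∘ cong toℕ
      ; (bwd e) → <⇒≢ (FoldedEdge⇒< e) ∘ cong toℕ ∘ sym
      }
  }

IsFloor : ∀ {n} → Fin n → Set
IsFloor v = toℕ v ≢ 0 × 2 ∣ toℕ v

-- The folded component is a path of odd vertices, the surface, with a floor hanging from each of them
-- and the vertex 0 as an additional leaf at the first.  The new edge closes a cycle of length k + 3.
-- Every vertex is at distance at most 1 from the surface, and two surface vertices are joined both along
-- the path and through the new edge; the shorter of the two routes gives the upper bound.
-- For the lower bound, the distance from 0 and (if the new edge misses it) the distance from the last
-- floor are bounded below by explicit functions that change by at most 1 along every edge.  They reach
-- the claimed diameter at the last floor, at the floor half-way around the cycle, or, if k is 2 or 3 and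
-- the new edge ends at the last floor, at the last surface vertex.
module Submission where

open import Defs
open import Data.Fin using (Fin; toℕ; zero; fromℕ<)
open import Data.Fin.Properties as Finᵖ using (any?; toℕ-fromℕ<; toℕ-injective; toℕ<n)
open import Data.Nat
  using (ℕ; zero; suc; s≤s; z≤n; _+_; _*_; _∸_; _≤_; _<_; _⊔_; _⊓_; ⌈_/2⌉; ∣_-_∣; _≤?_; _≟_)
open import Data.Nat.DivMod using (_/_; _%_; m*n/n≡m; m≡m%n+[m/n]*n)
open import Data.Nat.Induction using (<-rec)
open import Data.Nat.Properties hiding (_≤?_; _≟_)
open import Data.Nat.Tactic.RingSolver using (solve-∀)
open import Data.Product using (_×_; _,_; proj₂; ∃-syntax)
open import Data.Sum using (_⊎_; inj₁; inj₂; [_,_]′)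
open import Function using (_∘_)
open import Level using (0ℓ)
open import Relation.Binary.Construct.Closure.Symmetric using (SymClosure; fwd; bwd)
open import Relation.Binary.Core using (Rel)
open import Relation.Binary.Definitions using (Decidable)
open import Relation.Binary.PropositionalEquality
  using (_≡_; _≢_; refl; sym; trans; cong; cong₂; subst; subst₂)
open import Relation.Nullary using (¬_; Dec; yes; no; contradiction; map′; _×-dec_; _⊎-dec_)

-- Walks, distances and diameters in an arbitrary graph.

module _ (G : SimpleGraph) where

  Reach : ℕ → Rel (Vertex G) 0ℓ
  Reach d u v = ∃[ e ] (e ≤ d × Walk G e u v)

  Apart : ℕ → Set
  Apart d = ∃[ u ] ∃[ v ] (∀ {e} → Walk G e u v → d ≤ e)

module _ {G : SimpleGraph} where
  open SimpleGraph G using (_~_; ~-sym)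

  _++_ : ∀ {d e u v w} → Walk G d u v → Walk G e v w → Walk G (d + e) u w
  []      ++ q = q
  (a ∷ p) ++ q = a ∷ (p ++ q)

  reverse : ∀ {d u v} → Walk G d u v → Walk G d v u
  reverse [] = []
  reverse {u = u} {v} (_∷_ {n = n} a p) = subst (λ d → Walk G d v u) (+-comm n 1) (reverse p ++ (~-sym a ∷ []))

  reach-refl : ∀ {u} → Reach G 0 u u
  reach-refl = 0 , z≤n , []

  reach-step : ∀ {u v} → u ~ v → Reach G 1 u v
  reach-step a = 1 , ≤-refl , a ∷ []

  infixr 5 _⟫_
  _⟫_ : ∀ {d e u v w} → Reach G d u v → Reach G e v w → Reach G (d + e) u w
  (_ , a , p) ⟫ (_ , b , q) = _ , +-mono-≤ a b , p ++ q

  reach-sym : ∀ {d u v} → Reach G d u v → Reach G d v u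
  reach-sym (_ , a , p) = _ , a , reverse p

  reach-mono : ∀ {d e u v} → d ≤ e → Reach G d u v → Reach G e u v
  reach-mono d≤e (_ , a , p) = _ , ≤-trans a d≤e , p

  apart-mono : ∀ {d e} → d ≤ e → Apart G e → Apart G d
  apart-mono d≤e (u , v , far) = u , v , λ p → ≤-trans d≤e (far p)

  apart-⊔ : ∀ {d e} → Apart G d → Apart G e → Apart G (d ⊔ e)
  apart-⊔ {d} {e} p q =
    [ (λ eq → subst (Apart G) (sym eq) p) , (λ eq → subst (Apart G) (sym eq) q) ]′ (⊔-sel d e)

  -- The source of every lower bound: `f` gains at most one per step, so a large gain forces a long
  -- walk.
  potential-bound : (f : Vertex G → ℕ) → (∀ {u v} → u ~ v → f v ≤ suc (f u)) →
                    ∀ {e u v} → Walk G e u v → f v ≤ e + f u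
  potential-bound f lip []                = ≤-refl
  potential-bound f lip (_∷_ {n = e} {u = u} {v = v} a p) = ≤-trans (potential-bound f lip p)
    (≤-trans (+-monoʳ-≤ e (lip a)) (≤-reflexive (+-suc e (f u))))

  -- As walks of a given length can be decided, either a shorter walk is found and the descent goes
  -- on from it, or the present one is shortest.
  shortest : (∀ u v e → Dec (Walk G e u v)) → ∀ {u v} e → Walk G e u v →
             ∃[ d ] (IsDistance G u v d × d ≤ e)
  shortest walk? {u} {v} = <-rec _ λ e rec p → case-least e rec p (anyUpTo? (walk? u v) e)
    where
    case-least : ∀ e → (∀ {d} → d < e → Walk G d u v → ∃[ d′ ] (IsDistance G u v d′ × d′ ≤ d)) →
                 Walk G e u v → Dec (∃[ d ] (d < e × Walk G d u v)) →
                 ∃[ d ] (IsDistance G u v d × d ≤ e)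
    case-least e rec p (yes (d , d<e , q)) with rec d<e q
    ... | d′ , dist , d′≤d = d′ , dist , ≤-trans d′≤d (<⇒≤ d<e)
    case-least e rec p (no ¬q) = e , (p , λ q → ≮⇒≥ λ d<e → ¬q (_ , d<e , q)) , ≤-refl

  -- The pair from `Apart G D` is also joined by a walk of length at most `D`; the two bounds make
  -- its length exactly `D`.
  diameter : (∀ u v e → Dec (Walk G e u v)) → ∀ {D} → (∀ u v → Reach G D u v) → Apart G D → IsDiameter G D
  diameter walk? {D} reach (u , v , far) = bounded , u , v , attained (reach u v)
    where
    bounded : ∀ u v → ∃[ d ] (IsDistance G u v d × d ≤ D)
    bounded u v with reach u v
    ... | e , e≤D , p with shortest walk? e p
    ...   | d , dist , d≤e = d , dist , ≤-trans d≤e e≤D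

    attained : Reach G D u v → IsDistance G u v D
    attained (e , e≤D , p) with ≤-antisym e≤D (far p)
    ... | refl = p , far

-- Decidability of adjacency and of walks.

SymClosure? : ∀ {A : Set} {R : Rel A 0ℓ} → Decidable R → Decidable (SymClosure R)
SymClosure? R? a b = map′ [ fwd , bwd ]′ (λ { (fwd r) → inj₁ r ; (bwd r) → inj₂ r }) (R? a b ⊎-dec R? b a)

-- With the endpoints given by equations instead of constructor indices, the bounded parameter can
-- be found by search.
FoldedEdge? : ∀ n → Decidable (FoldedEdge n)
FoldedEdge? n a b = map′ to from
  (anyUpTo? (λ k → 1 ≤? k ×-dec (a ≟ 2 * k ∸ 1 ×-dec b ≟ 2 * k + 1)) (suc K) ⊎-dec
   (anyUpTo? (λ k → a ≟ 2 * k + 1 ×-dec b ≟ 2 * k + 2) (suc K) ⊎-dec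
    (a ≟ 0 ×-dec b ≟ 1)))
  where
  K = (n ∸ 3) / 2
  Parametrised : Set
  Parametrised =
    (∃[ k ] (k < suc K × 1 ≤ k × a ≡ 2 * k ∸ 1 × b ≡ 2 * k + 1)) ⊎
    (∃[ k ] (k < suc K × a ≡ 2 * k + 1 × b ≡ 2 * k + 2)) ⊎
    (a ≡ 0 × b ≡ 1)
  to : Parametrised → FoldedEdge n a b
  to (inj₁ (k , s≤s k≤K , 1≤k , refl , refl))     = odd-odd 1≤k k≤K
  to (inj₂ (inj₁ (k , s≤s k≤K , refl , refl)))    = odd-floor k≤K
  to (inj₂ (inj₂ (refl , refl)))                  = zero-one
  from : FoldedEdge n a b → Parametrised
  from (odd-odd 1≤k k≤K) = inj₁ (_ , s≤s k≤K , 1≤k , refl , refl)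
  from (odd-floor k≤K)   = inj₂ (inj₁ (_ , s≤s k≤K , refl , refl))
  from zero-one          = inj₂ (inj₂ (refl , refl))

addEdge-walk? : ∀ {n} {x y : Fin n} (x≢y : x ≢ y) → let G = addEdge (folded n) x y x≢y in
                ∀ u v e → Dec (Walk G e u v)
addEdge-walk? {n} {x} {y} x≢y u v zero    = map′ (λ { refl → [] }) (λ { [] → refl }) (u Finᵖ.≟ v)
addEdge-walk? {n} {x} {y} x≢y u v (suc e) = map′ (λ { (w , a , p) → a ∷ p }) (λ { (a ∷ p) → _ , a , p })
  (any? λ w → (SymClosure? (λ a b → FoldedEdge? n (toℕ a) (toℕ b)) u w
                ⊎-dec SymClosure? (λ a b → a Finᵖ.≟ x ×-dec b Finᵖ.≟ y) u w)
              ×-dec addEdge-walk? x≢y w v e)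

-- Numbers differing by at most one, and functions corrected at a point.

Close : Rel ℕ 0ℓ
Close a b = a ≤ suc b × b ≤ suc a

close-sym : ∀ {a b} → Close a b → Close b a
close-sym (p , q) = q , p

close-suc : ∀ a → Close a (suc a)
close-suc a = m≤n+m a 2 , ≤-refl

close-⊓ : ∀ {a b c d} → Close a b → Close c d → Close (a ⊓ c) (b ⊓ d)
close-⊓ (p , q) (p′ , q′) = ⊓-mono-≤ p p′ , ⊓-mono-≤ q q′

close-+ : ∀ {a b} c → Close a b → Close (a + c) (b + c)
close-+ c (p , q) = +-monoˡ-≤ c p , +-monoˡ-≤ c q

close-∣-∣ : ∀ {a b} c → Close a b → Close ∣ a - c ∣ ∣ b - c ∣
close-∣-∣ {a} {b} c (p , q) = one a b ∣a-b∣≤1 , one b a (≤-trans (≤-reflexive (∣-∣-comm b a)) ∣a-b∣≤1)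
  where
  one : ∀ x y → ∣ x - y ∣ ≤ 1 → ∣ x - c ∣ ≤ suc ∣ y - c ∣
  one x y h = ≤-trans (∣-∣-triangle x y c) (+-monoˡ-≤ ∣ y - c ∣ h)
  ∣a-b∣≤1 : ∣ a - b ∣ ≤ 1
  ∣a-b∣≤1 with ∣m-n∣≡[m∸n]∨[n∸m] a b
  ... | inj₁ eq = ≤-trans (≤-reflexive eq) (m≤n+o⇒m∸n≤o a b (≤-trans p (≤-reflexive (+-comm 1 b))))
  ... | inj₂ eq = ≤-trans (≤-reflexive eq) (m≤n+o⇒m∸n≤o b a (≤-trans q (≤-reflexive (+-comm 1 a))))

-- Serves floors whose distance from the source need not be one more than that of the surface vertex
-- above: the far end of the new edge, and the source itself.
override : ℕ → ℕ → (ℕ → ℕ) → ℕ → ℕ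
override a x f i with i ≟ a
... | yes _ = x
... | no _  = f i

override-at : ∀ a x f → override a x f a ≡ x
override-at a x f rewrite ≟-diag {a} refl = refl

override-off : ∀ {a x f i} → i ≢ a → override a x f i ≡ f i
override-off {a} {i = i} i≢a with i ≟ a
... | yes i≡a = contradiction i≡a i≢a
... | no _    = refl

override-elim : ∀ {a x f} (P : ℕ → ℕ → Set) → P a x → ∀ i → P i (f i) → P i (override a x f i)
override-elim {a} P px i pf with i ≟ a
... | yes refl = px
... | no _     = pf

-- Positions along the surface of the folded component.

module FoldedComponent (L : ℕ) where

  order = 3 + L * 2

  surface-index : ∀ {i} → i ≤ L → 1 + i * 2 < order
  surface-index i≤L = s≤s (s≤s (m≤n⇒m≤1+n (*-monoˡ-≤ 2 i≤L)))

  floor-index : ∀ {i} → i ≤ L → 2 + i * 2 < order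
  floor-index i≤L = s≤s (s≤s (s≤s (*-monoˡ-≤ 2 i≤L)))

  -- The bound is irrelevant so that different proofs of it give the same vertex.
  surface floor : ∀ i → .(i ≤ L) → Fin order
  surface i i≤L = fromℕ< (surface-index i≤L)
  floor   i i≤L = fromℕ< (floor-index i≤L)

  toℕ-surface : ∀ i .(i≤L : i ≤ L) → toℕ (surface i i≤L) ≡ 1 + i * 2
  toℕ-surface i i≤L = toℕ-fromℕ< (surface-index i≤L)

  toℕ-floor : ∀ i .(i≤L : i ≤ L) → toℕ (floor i i≤L) ≡ 2 + i * 2
  toℕ-floor i i≤L = toℕ-fromℕ< (floor-index i≤L)

  data Place : Fin order → Set where
    origin     : Place zero
    at-surface : ∀ i (i≤L : i ≤ L) → Place (surface i i≤L)
    at-floor   : ∀ i (i≤L : i ≤ L) → Place (floor i i≤L)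

  place : ∀ v → Place v
  place v with parity (toℕ v)
    where
    parity : ∀ a → a ≡ 0 ⊎ (∃[ i ] a ≡ 1 + i * 2) ⊎ (∃[ i ] a ≡ 2 + i * 2)
    parity 0 = inj₁ refl
    parity 1 = inj₂ (inj₁ (0 , refl))
    parity 2 = inj₂ (inj₂ (0 , refl))
    parity (suc (suc (suc a))) with parity (suc a)
    ... | inj₂ (inj₁ (i , eq)) = inj₂ (inj₁ (suc i , cong (2 +_) eq))
    ... | inj₂ (inj₂ (i , eq)) = inj₂ (inj₂ (suc i , cong (2 +_) eq))
  ... | inj₁ eq = subst Place (toℕ-injective (sym eq)) origin
  ... | inj₂ (inj₁ (i , eq)) = subst Place (toℕ-injective (trans (toℕ-surface i i≤L) (sym eq))) (at-surface i i≤L)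
    where
    i≤L : i ≤ L
    i≤L = ≤-pred (*-cancelʳ-< 2 i (suc L) (≤-pred (subst (_< order) eq (toℕ<n v))))
  ... | inj₂ (inj₂ (i , eq)) = subst Place (toℕ-injective (trans (toℕ-floor i i≤L) (sym eq))) (at-floor i i≤L)
    where
    i≤L : i ≤ L
    i≤L = *-cancelʳ-≤ i L 2 (≤-pred (≤-pred (≤-pred (subst (_< order) eq (toℕ<n v)))))

  bound≡L : (order ∸ 3) / 2 ≡ L
  bound≡L = m*n/n≡m L 2

  odd-index : ∀ i → 2 * i + 1 ≡ 1 + i * 2
  odd-index = solve-∀

  odd-index′ : ∀ i → 2 * suc i ∸ 1 ≡ 1 + i * 2
  odd-index′ i = cong (_∸ 1) (*-comm 2 (suc i))

  even-index : ∀ i → 2 * i + 2 ≡ 2 + i * 2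
  even-index = solve-∀

  surface-edge : ∀ {i} → suc i ≤ L → FoldedEdge order (1 + i * 2) (1 + suc i * 2)
  surface-edge {i} i<L = subst₂ (FoldedEdge order) (odd-index′ i) (odd-index (suc i))
    (odd-odd (s≤s z≤n) (subst (suc i ≤_) (sym bound≡L) i<L))

  floor-edge : ∀ {i} → i ≤ L → FoldedEdge order (1 + i * 2) (2 + i * 2)
  floor-edge {i} i≤L = subst₂ (FoldedEdge order) (odd-index i) (even-index i)
    (odd-floor (subst (i ≤_) (sym bound≡L) i≤L))

  -- A potential assembled from its values at vertex 0, along the surface and on the floors;
  -- removing two vertices at a time shifts both sequences.
  height : ℕ → (ℕ → ℕ) → (ℕ → ℕ) → ℕ → ℕ
  height o s f 0 = o
  height o s f 1 = s 0
  height o s f 2 = f 0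
  height o s f (suc (suc (suc a))) = height o (s ∘ suc) (f ∘ suc) (suc a)

  height-surface : ∀ o s f i → height o s f (1 + i * 2) ≡ s i
  height-surface o s f zero    = refl
  height-surface o s f (suc i) = height-surface o (s ∘ suc) (f ∘ suc) i

  height-floor : ∀ o s f i → height o s f (2 + i * 2) ≡ f i
  height-floor o s f zero    = refl
  height-floor o s f (suc i) = height-floor o (s ∘ suc) (f ∘ suc) i

  height-close : ∀ {o s f} → Close o (s 0) → (∀ {i} → i < L → Close (s i) (s (suc i))) →
                 (∀ {i} → i ≤ L → Close (s i) (f i)) →
                 ∀ {a b} → FoldedEdge order a b → Close (height o s f a) (height o s f b)
  -- The edge with parameter `suc i` leaves position `i`; `1 ≤ k` excludes the parameter 0.
  height-close {o} {s} {f} os ss sf (odd-odd {suc i} _ i<L) =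
    subst₂ (λ a b → Close (height o s f a) (height o s f b)) (sym (odd-index′ i)) (sym (odd-index (suc i)))
      (subst₂ Close (sym (height-surface o s f i)) (sym (height-surface o s f (suc i)))
        (ss (subst (suc i ≤_) bound≡L i<L)))
  height-close {o} {s} {f} os ss sf (odd-floor {i} i≤L) =
    subst₂ (λ a b → Close (height o s f a) (height o s f b)) (sym (odd-index i)) (sym (even-index i))
      (subst₂ Close (sym (height-surface o s f i)) (sym (height-floor o s f i))
        (sf (subst (i ≤_) bound≡L i≤L)))
  height-close os ss sf zero-one = os

-- Arithmetic of the two routes between surface vertices.

sum-bound : ∀ {x y s} → x + y ≤ suc (s + s) → x ≤ s ⊎ y ≤ s
sum-bound {x} {y} {s} h with x ≤? s | y ≤? s
... | yes x≤s | _       = inj₁ x≤s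
... | no _    | yes y≤s = inj₂ y≤s
... | no x≰s  | no y≰s  = contradiction
  (≤-trans (s≤s (≤-reflexive (sym (+-suc s s)))) (≤-trans (+-mono-≤ (≰⇒> x≰s) (≰⇒> y≰s)) h)) (n≮n _)

n≤⌈n/2⌉+⌈n/2⌉ : ∀ n → n ≤ ⌈ n /2⌉ + ⌈ n /2⌉
n≤⌈n/2⌉+⌈n/2⌉ n = ≤-trans (≤-reflexive (sym (⌊n/2⌋+⌈n/2⌉≡n n))) (+-monoˡ-≤ ⌈ n /2⌉ (⌊n/2⌋≤⌈n/2⌉ n))

⌈n/2⌉+⌈n/2⌉≤1+n : ∀ n → ⌈ n /2⌉ + ⌈ n /2⌉ ≤ suc n
⌈n/2⌉+⌈n/2⌉≤1+n 0             = z≤n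
⌈n/2⌉+⌈n/2⌉≤1+n 1             = ≤-refl
⌈n/2⌉+⌈n/2⌉≤1+n (suc (suc n)) =
  s≤s (≤-trans (≤-reflexive (+-suc ⌈ n /2⌉ ⌈ n /2⌉)) (s≤s (⌈n/2⌉+⌈n/2⌉≤1+n n)))

-- The threshold 4 comes from here: at `n = 3` both sides agree. The floor half-way around the cycle
-- is thereby kept off the far end of the new edge.
1+⌈n/2⌉<n : ∀ {n} → 4 ≤ n → suc ⌈ n /2⌉ < n
1+⌈n/2⌉<n {suc (suc (suc (suc n)))} (s≤s (s≤s (s≤s (s≤s _)))) = s≤s (s≤s (s≤s (s≤s (⌈n/2⌉≤n n))))

-- The two routes between the places i ≤ j together run once around the cycle closed by the new edge, of
-- length k + 3, and twice along the part a of the way outside of it.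
around : ∀ {x y c k S} a → x + y ≡ 3 + (k + (a + a)) → k ≤ c + c → a + suc c ≤ S → x ≤ S ⊎ y ≤ S
around {x} {y} {c} {k} {S} a eq k≤2c a+c<S = sum-bound (begin
  x + y                           ≡⟨ eq ⟩
  3 + (k + (a + a))               ≤⟨ +-monoʳ-≤ 3 (+-monoˡ-≤ (a + a) k≤2c) ⟩
  3 + ((c + c) + (a + a))         ≡⟨ regroup a c ⟩
  suc ((a + suc c) + (a + suc c)) ≤⟨ s≤s (+-mono-≤ a+c<S a+c<S) ⟩
  suc (S + S)                     ∎)
  where
  open ≤-Reasoning
  regroup : ∀ a c → 3 + ((c + c) + (a + a)) ≡ suc ((a + suc c) + (a + suc c))
  regroup = solve-∀

-- If `i ≤ M` and `M + k ≤ j`, the route through the new edge has length at most `M + (3 + r)`.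
-- Otherwise `around` applies, with the part outside the cycle on the left, absent, or on the right.
two-routes : ∀ {M k r c S i j} → k ≤ c + c → M + (3 + r) ≤ S → c + suc r ≤ S → M + suc c ≤ S →
             i ≤ j → j ≤ M + k + r → ∣ i - j ∣ ≤ S ⊎ ∣ i - M ∣ + (3 + ∣ M + k - j ∣) ≤ S
two-routes {M} {k} {r} {c} {S} {i} {j} k≤2c A B C i≤j j≤L
  with m≤n⇒∃[o]m+o≡n i≤j | ≤-total i M | ≤-total j (M + k)
... | t , refl | inj₁ i≤M | inj₁ j≤Q with m≤n⇒∃[o]m+o≡n i≤M | m≤n⇒∃[o]m+o≡n j≤Q
...   | a , refl | b , j+b≡Q
  rewrite ∣m-m+n∣≡n i t | ∣m-m+n∣≡n i a | sym j+b≡Q | ∣-∣-comm (i + t + b) (i + t) | ∣m-m+n∣≡n (i + t) b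
  = around a (trans (regroup t a b) (trans (cong (λ s → 3 + (a + s)) t+b≡a+k) (regroup′ a k))) k≤2c
      (≤-trans (+-monoˡ-≤ (suc c) (m≤n+m a i)) C)
  where
  t+b≡a+k : t + b ≡ a + k
  t+b≡a+k = +-cancelˡ-≡ i _ _ (trans (sym (+-assoc i t b)) (trans j+b≡Q (+-assoc i a k)))
  regroup : ∀ t a b → t + (a + (3 + b)) ≡ 3 + (a + (t + b))
  regroup = solve-∀
  regroup′ : ∀ a k → 3 + (a + (a + k)) ≡ 3 + (k + (a + a))
  regroup′ = solve-∀
two-routes {M} {k} {r} {c} {S} {i} {j} k≤2c A B C i≤j j≤L
    | t , refl | inj₁ i≤M | inj₂ Q≤j with m≤n⇒∃[o]m+o≡n i≤M | m≤n⇒∃[o]m+o≡n Q≤j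
...   | a , refl | b , Q+b≡j
  rewrite sym Q+b≡j | ∣m-m+n∣≡n i a | ∣m-m+n∣≡n (i + a + k) b
  = inj₂ (≤-trans (+-mono-≤ (m≤n+m a i) (+-monoʳ-≤ 3 (+-cancelˡ-≤ (i + a + k) b r j≤L))) A)
two-routes {M} {k} {r} {c} {S} {i} {j} k≤2c A B C i≤j j≤L
    | t , refl | inj₂ M≤i | inj₁ j≤Q with m≤n⇒∃[o]m+o≡n M≤i | m≤n⇒∃[o]m+o≡n j≤Q
...   | a , refl | b , j+b≡Q
  rewrite ∣m-m+n∣≡n (M + a) t | ∣-∣-comm (M + a) M | ∣m-m+n∣≡n M a | sym j+b≡Q
        | ∣-∣-comm (M + a + t + b) (M + a + t) | ∣m-m+n∣≡n (M + a + t) b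
  = around 0 (trans (regroup t a b) (cong (3 +_) (trans a+t+b≡k (sym (+-identityʳ k))))) k≤2c
      (≤-trans (m≤n+m (suc c) M) C)
  where
  a+t+b≡k : a + t + b ≡ k
  a+t+b≡k = +-cancelˡ-≡ M _ _ (trans (regroup″ M a t b) j+b≡Q)
    where
    regroup″ : ∀ M a t b → M + (a + t + b) ≡ M + a + t + b
    regroup″ = solve-∀
  regroup : ∀ t a b → t + (a + (3 + b)) ≡ 3 + (a + t + b)
  regroup = solve-∀
two-routes {M} {k} {r} {c} {S} {i} {j} k≤2c A B C i≤j j≤L
    | t , refl | inj₂ M≤i | inj₂ Q≤j with m≤n⇒∃[o]m+o≡n M≤i | m≤n⇒∃[o]m+o≡n Q≤j
...   | a , refl | b , Q+b≡j
  rewrite ∣m-m+n∣≡n (M + a) t | ∣-∣-comm (M + a) M | ∣m-m+n∣≡n M a | sym Q+b≡j | ∣m-m+n∣≡n (M + k) b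
  = around b (trans (regroup t a b) (trans (cong (λ s → 3 + (s + b)) a+t≡k+b) (regroup′ k b))) k≤2c
      (≤-trans (≤-trans (+-monoˡ-≤ (suc c) b≤r) (≤-reflexive (regroup″ r c))) B)
  where
  b≤r : b ≤ r
  b≤r = +-cancelˡ-≤ (M + k) b r j≤L
  a+t≡k+b : a + t ≡ k + b
  a+t≡k+b = +-cancelˡ-≡ M _ _ (trans (sym (+-assoc M a t)) (trans (sym Q+b≡j) (+-assoc M k b)))
  regroup : ∀ t a b → t + (a + (3 + b)) ≡ 3 + (a + t + b)
  regroup = solve-∀
  regroup′ : ∀ k b → 3 + (k + b + b) ≡ 3 + (k + (b + b))
  regroup′ = solve-∀
  regroup″ : ∀ r c → r + suc c ≡ c + suc r
  regroup″ = solve-∀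

-- Surface distances in the presence of the new edge.

close-suc-cong : ∀ {a b} → Close a b → Close (suc a) (suc b)
close-suc-cong (p , q) = s≤s p , s≤s q

-- If the new edge joins the floors below the surface places at distances P < Q from a source along the
-- surface, then it connects these places by a path of length 3; shortcut P Q c is the resulting
-- distance from the source to the surface place at distance c.
shortcut : (P Q c : ℕ) → ℕ
shortcut P Q c = c ⊓ (∣ c - Q ∣ + (3 + P))

module _ {P Q : ℕ} where

  shortcut-close : ∀ {c d} → Close c d → Close (shortcut P Q c) (shortcut P Q d)
  shortcut-close cd = close-⊓ cd (close-+ (3 + P) (close-∣-∣ Q cd))

  shortcut-near : shortcut P Q P ≡ P
  shortcut-near = m≤n⇒m⊓n≡m (≤-trans (m≤n+m P 3) (m≤n+m (3 + P) ∣ P - Q ∣))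

  -- The floor at the far end gets height `3 + P`, its distance through the new edge; `P < Q` makes
  -- this at most `2 + Q`, the height of that floor reached along the surface.
  shortcut-far : P < Q → Close (suc (shortcut P Q Q)) (3 + P)
  shortcut-far P<Q rewrite ∣n-n∣≡0 Q =
    s≤s (m⊓n≤n Q (3 + P)) , s≤s (s≤s (⊓-glb P<Q (m≤n+m (suc P) 2)))

close-∸ : ∀ {i L} → i < L → Close (L ∸ i) (L ∸ suc i)
close-∸ {i} {L} i<L = ≤-reflexive (sym (suc-pred-∸ i<L)) , ≤-trans (∸-monoʳ-≤ L (n≤1+n i)) (n≤1+n _)
  where
  suc-pred-∸ : ∀ {i L} → i < L → suc (L ∸ suc i) ≡ L ∸ i
  suc-pred-∸ {i} {L} i<L = sym (+-∸-assoc 1 i<L)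

-- The folded component with the new edge.

module BridgedComponent (M k r : ℕ) (1≤k : 1 ≤ k) where

  -- Counting `M` positions before the new edge, `k` across it and `r` after it turns all lengths
  -- into sums.
  Q L : ℕ
  Q = M + k
  L = Q + r

  open FoldedComponent L public

  Q≤L : Q ≤ L
  Q≤L = m≤m+n Q r

  M≤L : M ≤ L
  M≤L = ≤-trans (m≤m+n M k) Q≤L

  M<Q : M < Q
  M<Q = m<m+n M 1≤k

  module _ (x≢y : floor M M≤L ≢ floor Q Q≤L) where

    bridged : SimpleGraph
    bridged = addEdge (folded order) (floor M M≤L) (floor Q Q≤L) x≢y

    open SimpleGraph bridged using (_~_)

    -- Besides the edges of the folded component, only the two floors joined by the new edge have to
    -- be compared.
    height-bound : ∀ {o s f} → Close o (s 0) → (∀ {i} → i < L → Close (s i) (s (suc i))) →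
                   (∀ {i} → i ≤ L → Close (s i) (f i)) → Close (f M) (f Q) →
                   ∀ {e u v} → Walk bridged e u v → height o s f (toℕ v) ≤ e + height o s f (toℕ u)
    height-bound {o} {s} {f} os ss sf fMQ = potential-bound (h ∘ toℕ) (proj₂ ∘ close)
      where
      h : ℕ → ℕ
      h = height o s f
      h-floor : ∀ i .(i≤L : i ≤ L) → f i ≡ h (toℕ (floor i i≤L))
      h-floor i i≤L = sym (trans (cong h (toℕ-floor i i≤L)) (height-floor o s f i))
      bridge : Close (h (toℕ (floor M M≤L))) (h (toℕ (floor Q Q≤L)))
      bridge = subst₂ Close (h-floor M M≤L) (h-floor Q Q≤L) fMQ
      close : ∀ {u v} → u ~ v → Close (h (toℕ u)) (h (toℕ v))
      close (inj₁ (fwd e))             = height-close os ss sf e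
      close (inj₁ (bwd e))             = close-sym (height-close os ss sf e)
      close (inj₂ (fwd (refl , refl))) = bridge
      close (inj₂ (bwd (refl , refl))) = close-sym bridge

    -- Lower bounds: heights measured from either end.

    module FromOrigin where
      -- The distances from vertex 0: one step leads to the surface, and `M` surface steps, a step
      -- down and the new edge lead on to the floor at `Q`.
      s f : ℕ → ℕ
      s i = suc (shortcut M Q i)
      f   = override Q (3 + M) (suc ∘ s)

      far : ∀ {e v} → Walk bridged e zero v → height 0 s f (toℕ v) ≤ e
      far {e} p = ≤-trans (height-bound (close-suc 0) (λ {i} _ → close-suc-cong (shortcut-close (close-suc i)))
          (λ {i} _ → override-elim (λ i b → Close (s i) b) (shortcut-far M<Q) i (close-suc (s i)))
          bridge p) (≤-reflexive (+-identityʳ e))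
        where
        bridge : Close (f M) (f Q)
        bridge rewrite override-off {x = 3 + M} {f = suc ∘ s} (<⇒≢ M<Q) | override-at Q (3 + M) (suc ∘ s)
          | shortcut-near {M} {Q} = close-suc (2 + M)

      apart-surface : ∀ {i} → i ≤ L → Apart bridged (suc (shortcut M Q i))
      apart-surface {i} i≤L = zero , surface i i≤L , λ p →
        ≤-trans (≤-reflexive (sym (trans (cong (height 0 s f) (toℕ-surface i i≤L)) (height-surface 0 s f i)))) (far p)

      apart-floor : ∀ {i} → i ≤ L → Apart bridged (f i)
      apart-floor {i} i≤L = zero , floor i i≤L , λ p →
        ≤-trans (≤-reflexive (sym (trans (cong (height 0 s f) (toℕ-floor i i≤L)) (height-floor 0 s f i)))) (far p)

    module FromLastFloor (1≤r : 1 ≤ r) where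
      -- The mirror image, with `L ∸ i` as the surface distance: the near end of the new edge is now
      -- `Q`, at distance `r`, the far end `M`, at `r + k`. The source is a floor and gets height 0;
      -- `1 ≤ r` separates it from `Q`.
      s f : ℕ → ℕ
      s i = suc (shortcut r (r + k) (L ∸ i))
      f   = override L 0 (override M (3 + r) (suc ∘ s))

      Q<L : Q < L
      Q<L = m<m+n Q 1≤r

      L∸Q : L ∸ Q ≡ r
      L∸Q = m+n∸m≡n Q r

      L∸M : L ∸ M ≡ r + k
      L∸M = trans (cong (_∸ M) (+-assoc M k r)) (trans (m+n∸m≡n M (k + r)) (+-comm k r))

      far : ∀ {e v} → Walk bridged e (floor L ≤-refl) v → height (suc (s 0)) s f (toℕ v) ≤ e
      far {e} p = ≤-trans (height-bound (close-sym (close-suc (s 0)))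
          (λ i<L → close-suc-cong (shortcut-close (close-∸ i<L)))
          (λ {i} _ → override-elim (λ i b → Close (s i) b) end i
            (override-elim (λ i b → Close (s i) b) bridge-end i (close-suc (s i))))
          bridge p) (≤-reflexive (trans (cong (e +_) source) (+-identityʳ e)))
        where
        end : Close (s L) 0
        end rewrite n∸n≡0 L = close-sym (close-suc 0)
        bridge-end : Close (s M) (3 + r)
        bridge-end rewrite L∸M = shortcut-far (m<m+n r 1≤k)
        bridge : Close (f M) (f Q)
        bridge rewrite override-off {x = 0} {f = override M (3 + r) (suc ∘ s)} (<⇒≢ (<-trans M<Q Q<L))
          | override-off {x = 0} {f = override M (3 + r) (suc ∘ s)} (<⇒≢ Q<L)
          | override-at M (3 + r) (suc ∘ s)
          | override-off {x = 3 + r} {f = suc ∘ s} (>⇒≢ M<Q)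
          | L∸Q | shortcut-near {r} {r + k} = close-sym (close-suc (2 + r))
        source : height (suc (s 0)) s f (toℕ (floor L ≤-refl)) ≡ 0
        source = trans (cong (height (suc (s 0)) s f) (toℕ-floor L ≤-refl))
          (trans (height-floor (suc (s 0)) s f L) (override-at L 0 (override M (3 + r) (suc ∘ s))))

      apart-floor : ∀ {i} → i < L → i ≢ M → Apart bridged (2 + shortcut r (r + k) (L ∸ i))
      apart-floor {i} i<L i≢M = floor L ≤-refl , floor i (<⇒≤ i<L) , λ p → ≤-trans (≤-reflexive (sym value)) (far p)
        where
        value : height (suc (s 0)) s f (toℕ (floor i (<⇒≤ i<L))) ≡ 2 + shortcut r (r + k) (L ∸ i)
        value = trans (cong (height (suc (s 0)) s f) (toℕ-floor i (<⇒≤ i<L)))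
          (trans (height-floor (suc (s 0)) s f i)
            (trans (override-off (<⇒≢ i<L)) (override-off i≢M)))

    -- Upper bounds: explicit walks.

    module Walks where
      along : ∀ {i j} (i≤L : i ≤ L) (j≤L : j ≤ L) → Reach bridged ∣ i - j ∣ (surface i i≤L) (surface j j≤L)
      along {i} {j} i≤L j≤L =
        [ up i≤L j≤L , (λ j≤i → reach-mono (≤-reflexive (∣-∣-comm j i)) (reach-sym (up j≤L i≤L j≤i))) ]′ (≤-total i j)
        where
        climb : ∀ t {i j} (i≤L : i ≤ L) (j≤L : j ≤ L) → i + t ≡ j → Reach bridged t (surface i i≤L) (surface j j≤L)
        climb zero    {i} i≤L j≤L eq with trans (sym (+-identityʳ i)) eq
        ... | refl = reach-refl
        climb (suc t) {i} i≤L j≤L refl = reach-step (inj₁ (fwd step)) ⟫ climb t i<L j≤L (sym (+-suc i t))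
          where
          i<L : suc i ≤ L
          i<L = ≤-trans (≤-trans (m≤m+n (suc i) t) (≤-reflexive (sym (+-suc i t)))) j≤L
          step : FoldedEdge order (toℕ (surface i i≤L)) (toℕ (surface (suc i) i<L))
          step = subst₂ (FoldedEdge order) (sym (toℕ-surface i i≤L)) (sym (toℕ-surface (suc i) i<L))
            (surface-edge i<L)

        up : ∀ {i j} (i≤L : i ≤ L) (j≤L : j ≤ L) → i ≤ j → Reach bridged ∣ i - j ∣ (surface i i≤L) (surface j j≤L)
        up {i} i≤L j≤L i≤j with m≤n⇒∃[o]m+o≡n i≤j
        ... | t , refl = reach-mono (≤-reflexive (sym (∣m-m+n∣≡n i t))) (climb t i≤L j≤L refl)

      down : ∀ {i} (i≤L : i ≤ L) → Reach bridged 1 (surface i i≤L) (floor i i≤L)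
      down {i} i≤L = reach-step (inj₁ (fwd
        (subst₂ (FoldedEdge order) (sym (toℕ-surface i i≤L)) (sym (toℕ-floor i i≤L)) (floor-edge i≤L))))

      bridge : Reach bridged 1 (floor M M≤L) (floor Q Q≤L)
      bridge = reach-step (inj₂ (fwd (refl , refl)))

      -- The detour down, across and up that `shortcut` counts as 3.
      cross : Reach bridged 3 (surface M M≤L) (surface Q Q≤L)
      cross = down M≤L ⟫ bridge ⟫ reach-sym (down Q≤L)

      -- The position of a surface vertex at most one step away; vertex 0 behaves like a second
      -- floor at position 0.
      index : ∀ {v} → Place v → ℕ
      index origin           = 0
      index (at-surface i _) = i
      index (at-floor i _)   = i

      index≤L : ∀ {v} (p : Place v) → index p ≤ L
      index≤L origin             = z≤n
      index≤L (at-surface i i≤L) = i≤L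
      index≤L (at-floor i i≤L)   = i≤L

      rise : ∀ {v} (p : Place v) → Reach bridged 1 v (surface (index p) (index≤L p))
      rise origin           = reach-step (inj₁ (fwd (subst (FoldedEdge order 0) (sym (toℕ-surface 0 z≤n)) zero-one)))
      rise (at-surface i _) = reach-mono z≤n reach-refl
      rise (at-floor i i≤L) = reach-sym (down i≤L)

      ordered : ∀ {D} → (∀ {u v} (p : Place u) (q : Place v) → index p ≤ index q → Reach bridged D u v) →
                ∀ u v → Reach bridged D u v
      ordered reach u v = [ reach (place u) (place v) , reach-sym ∘ reach (place v) (place u) ]′
        (≤-total (index (place u)) (index (place v)))

      -- The 2 pays for one step onto the surface and one step off it.
      via-surface : ∀ {S} → (∀ {i j} → i ≤ j → j ≤ L → ∣ i - j ∣ ≤ S ⊎ ∣ i - M ∣ + (3 + ∣ Q - j ∣) ≤ S) →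
                    ∀ u v → Reach bridged (2 + S) u v
      via-surface {S} short = ordered λ p q p≤q →
        reach-mono (≤-reflexive (cong suc (+-comm S 1)))
          (rise p ⟫ surfaces p q (short p≤q (index≤L q)) ⟫ reach-sym (rise q))
        where
        surfaces : ∀ {u v} (p : Place u) (q : Place v) →
                   ∣ index p - index q ∣ ≤ S ⊎ ∣ index p - M ∣ + (3 + ∣ Q - index q ∣) ≤ S →
                   Reach bridged S (surface (index p) (index≤L p)) (surface (index q) (index≤L q))
        surfaces p q (inj₁ h) = reach-mono h (along (index≤L p) (index≤L q))
        surfaces p q (inj₂ h) = reach-mono h
          (along (index≤L p) M≤L ⟫ cross ⟫ along Q≤L (index≤L q))

      -- If the new edge ends at the last floor, that floor is reached through it instead of along the
      -- surface, which is shorter by at least one as k ≥ 2.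
      bridge-to-end : 2 ≤ k → L ≡ Q → ∀ u v → Reach bridged (suc L) u v
      bridge-to-end 2≤k L≡Q = ordered go
        where
        distance≤ : ∀ {i j} → i ≤ j → ∣ i - j ∣ ≤ j
        distance≤ {i} {j} i≤j = ≤-trans (≤-reflexive (m≤n⇒∣m-n∣≡n∸m i≤j)) (m∸n≤m j i)
        to-Q : ∀ {u} (p : Place u) → Reach bridged (suc L) u (floor Q Q≤L)
        to-Q p with index p ≤? M
        ... | yes i≤M = reach-mono bound (rise p ⟫ along (index≤L p) M≤L ⟫ down M≤L ⟫ bridge)
          where
          bound : 1 + (∣ index p - M ∣ + 2) ≤ suc L
          bound = s≤s (≤-trans (+-mono-≤ (distance≤ i≤M) 2≤k) Q≤L)
        -- Past `M` the position is at least 1, and this pays for the step down.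
        ... | no i≰M = reach-mono (s≤s bound) (rise p ⟫ along (index≤L p) Q≤L ⟫ down Q≤L)
          where
          bound : ∣ index p - Q ∣ + 1 ≤ L
          bound = ≤-trans (+-monoˡ-≤ 1 (≤-trans
              (≤-reflexive (m≤n⇒∣m-n∣≡n∸m (≤-trans (index≤L p) (≤-reflexive L≡Q))))
              (∸-monoʳ-≤ Q (≤-trans (s≤s z≤n) (≰⇒> i≰M)))))
            (≤-trans (≤-reflexive (m∸n+n≡m (≤-trans (s≤s z≤n) M<Q))) Q≤L)
        go : ∀ {u v} (p : Place u) (q : Place v) → index p ≤ index q → Reach bridged (suc L) u v
        go p origin           i≤0 = reach-mono (s≤s (+-mono-≤ (distance≤ i≤0) 1≤L))
          (rise p ⟫ along (index≤L p) z≤n ⟫ reach-sym (rise origin))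
          where
          1≤L : 1 ≤ L
          1≤L = ≤-trans (≤-trans (s≤s z≤n) M<Q) Q≤L
        go p (at-surface j h) i≤j = reach-mono (s≤s (≤-trans (distance≤ i≤j) h)) (rise p ⟫ along (index≤L p) h)
        go p (at-floor j h)   i≤j with j ≟ Q
        ... | yes refl = to-Q p
        -- This floor is not the last one, so `j < L` leaves room for the step down.
        ... | no j≢Q   = reach-mono (s≤s bound) (rise p ⟫ along (index≤L p) h ⟫ down h)
          where
          bound : ∣ index p - j ∣ + 1 ≤ L
          bound = ≤-trans (≤-reflexive (+-comm _ 1)) (≤-trans (s≤s (distance≤ i≤j))
            (≤∧≢⇒< h λ j≡L → j≢Q (trans j≡L L≡Q)))

    -- The diameter in each of the three cases.

    private
      c : ℕ
      c = ⌈ k /2⌉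

    -- `A` is attained between vertex 0 and the last floor, `C` and `B` between one of these and a
    -- floor half-way around the cycle. If `r` is 0, the last floor is an end of the new edge and
    -- `C` dominates both `A` and `B`.
    diameter-long : 4 ≤ k → IsDiameter bridged (2 + ((M + (3 + r)) ⊔ (c + suc r) ⊔ (M + suc c)))
    diameter-long 4≤k = diameter (addEdge-walk? x≢y)
      (Walks.via-surface (two-routes (n≤⌈n/2⌉+⌈n/2⌉ k)
        (≤-trans (m≤m⊔n A B) (m≤m⊔n (A ⊔ B) C)) (≤-trans (m≤n⊔m A B) (m≤m⊔n (A ⊔ B) C)) (m≤n⊔m (A ⊔ B) C)))
      (apart-⊔ (apart-⊔ (ends (1 ≤? r)) (right (1 ≤? r))) left)
      where
      A B C : ℕ
      A = M + (3 + r)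
      B = c + suc r
      C = M + suc c

      2≤c : 2 ≤ c
      2≤c = ⌈n/2⌉-mono 4≤k

      -- From the near end, the surface takes `suc c` steps and the new edge `3 + (k ∸ suc c)`; the
      -- former is no longer because `c + c ≤ suc k`. Used with `P = M` and with `P = r`.
      halfway : ∀ P → shortcut P (P + k) (P + suc c) ≡ P + suc c
      halfway P = m≤n⇒m⊓n≡m (begin
        P + suc c                              ≡⟨ +-comm P (suc c) ⟩
        suc c + P                              ≤⟨ +-monoˡ-≤ P 1+c≤ ⟩
        (k ∸ suc c) + 3 + P                    ≡⟨ +-assoc (k ∸ suc c) 3 P ⟩
        (k ∸ suc c) + (3 + P)                  ≡⟨ cong (_+ (3 + P)) (sym (m≤n⇒∣m-n∣≡n∸m 1+c≤k)) ⟩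
        ∣ suc c - k ∣ + (3 + P)                ≡⟨ cong (_+ (3 + P)) (sym (∣m+n-m+o∣≡∣n-o∣ P (suc c) k)) ⟩
        ∣ P + suc c - P + k ∣ + (3 + P)        ∎)
        where
        open ≤-Reasoning
        1+c≤k : suc c ≤ k
        1+c≤k = <⇒≤ (1+⌈n/2⌉<n 4≤k)
        1+c≤ : suc c ≤ (k ∸ suc c) + 3
        1+c≤ = +-cancelʳ-≤ (suc c) (suc c) _ (begin
          suc c + suc c               ≡⟨ cong suc (+-suc c c) ⟩
          2 + (c + c)                 ≤⟨ +-monoʳ-≤ 2 (⌈n/2⌉+⌈n/2⌉≤1+n k) ⟩
          3 + k                       ≡⟨ cong (3 +_) (sym (m∸n+n≡m 1+c≤k)) ⟩
          3 + (k ∸ suc c + suc c)     ≡⟨ regroup (k ∸ suc c) (suc c) ⟩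
          (k ∸ suc c) + 3 + suc c     ∎)
          where
          regroup : ∀ a b → 3 + (a + b) ≡ a + 3 + b
          regroup = solve-∀

      left : Apart bridged (2 + C)
      left = subst (Apart bridged) (trans (override-off (<⇒≢ C<Q)) (cong (2 +_) (halfway M)))
        (FromOrigin.apart-floor (<⇒≤ (≤-trans C<Q Q≤L)))
        where
        C<Q : C < Q
        C<Q = +-monoʳ-< M (1+⌈n/2⌉<n 4≤k)

      ends : Dec (1 ≤ r) → Apart bridged (2 + A)
      ends (yes 1≤r) = apart-mono
        (≤-trans (+-monoʳ-≤ 2 (⊓-glb A≤L (≤-reflexive (trans (regroup M r) (cong (_+ (3 + M)) (sym ∣L-Q∣≡r))))))
          (≤-reflexive (sym (override-off {x = 3 + M} {f = suc ∘ FromOrigin.s} (>⇒≢ (FromLastFloor.Q<L 1≤r))))))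
        (FromOrigin.apart-floor ≤-refl)
        where
        -- As `3 ≤ k`, the way through the new edge is no longer than the surface.
        A≤L : A ≤ L
        A≤L = ≤-trans (+-monoʳ-≤ M (+-monoˡ-≤ r (<⇒≤ 4≤k))) (≤-reflexive (sym (+-assoc M k r)))
        regroup : ∀ M r → M + (3 + r) ≡ r + (3 + M)
        regroup = solve-∀
        ∣L-Q∣≡r : ∣ L - Q ∣ ≡ r
        ∣L-Q∣≡r = trans (∣-∣-comm L Q) (∣m-m+n∣≡n Q r)
      ends (no 1≰r) = apart-mono (+-monoʳ-≤ 2 (+-monoʳ-≤ M (≤-trans (+-monoʳ-≤ 3 r≤0) (s≤s 2≤c)))) left
        where
        r≤0 : r ≤ 0
        r≤0 = ≤-pred (≰⇒> 1≰r)

      right : Dec (1 ≤ r) → Apart bridged (2 + B)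
      right (yes 1≤r) = subst (Apart bridged)
          (cong (2 +_) (trans (cong (shortcut r (r + k)) L∸i≡d) (trans (halfway r) (regroup r c))))
          (FromLastFloor.apart-floor 1≤r i<L i≢M)
        where
        d i : ℕ
        d = r + suc c
        -- `0 < d` keeps this position off `L` and `d < r + k` off `M`, the two floors with
        -- corrected heights.
        i = L ∸ d
        regroup : ∀ r c → r + suc c ≡ c + suc r
        regroup = solve-∀
        d<r+k : d < r + k
        d<r+k = +-monoʳ-< r (1+⌈n/2⌉<n 4≤k)
        d≤L : d ≤ L
        d≤L = ≤-trans (<⇒≤ d<r+k) (≤-trans (≤-reflexive (sym (FromLastFloor.L∸M 1≤r))) (m∸n≤m L M))
        L∸i≡d : L ∸ i ≡ d
        L∸i≡d = m∸[m∸n]≡n d≤L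
        i<L : i < L
        i<L = ≤∧≢⇒< (m∸n≤m L d) λ i≡L → contradiction
          (trans (sym (+-suc r c)) (trans (sym L∸i≡d) (trans (cong (L ∸_) i≡L) (n∸n≡0 L)))) λ ()
        i≢M : i ≢ M
        i≢M i≡M = <⇒≢ d<r+k (trans (sym L∸i≡d) (trans (cong (L ∸_) i≡M) (FromLastFloor.L∸M 1≤r)))
      right (no 1≰r) = apart-mono (+-monoʳ-≤ 2 (≤-trans (+-monoʳ-≤ c (s≤s (≤-pred (≰⇒> 1≰r))))
        (≤-trans (≤-reflexive (+-comm c 1)) (m≤n+m (suc c) M)))) left

    -- The detour replaces `k` surface steps by 3 others, which gains nothing here.
    shortcut-useless : k ≤ 3 → shortcut M Q L ≡ L
    shortcut-useless k≤3 = m≤n⇒m⊓n≡m (begin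
      M + k + r             ≤⟨ +-monoˡ-≤ r (+-monoʳ-≤ M k≤3) ⟩
      M + 3 + r             ≡⟨ regroup M r ⟩
      r + (3 + M)           ≡⟨ cong (_+ (3 + M)) (sym (trans (∣-∣-comm L Q) (∣m-m+n∣≡n Q r))) ⟩
      ∣ L - Q ∣ + (3 + M)   ∎)
      where
      open ≤-Reasoning
      regroup : ∀ M r → M + 3 + r ≡ r + (3 + M)
      regroup = solve-∀

    -- The last floor is close through the new edge; the last surface vertex takes its place as a
    -- farthest vertex from 0.
    diameter-end : 2 ≤ k → k ≤ 3 → r ≡ 0 → IsDiameter bridged (suc L)
    diameter-end 2≤k k≤3 r≡0 = diameter (addEdge-walk? x≢y)
      (Walks.bridge-to-end 2≤k (trans (cong (Q +_) r≡0) (+-identityʳ Q)))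
      (subst (Apart bridged) (cong suc (shortcut-useless k≤3)) (FromOrigin.apart-surface ≤-refl))

    -- The surface alone gives the upper bound, and the last floor attains it from vertex 0. If
    -- `1 ≤ r`, that floor is not on the new edge; if `k ≡ 1` and `r` is 0, it is, but `3 + M`
    -- equals `2 + L`.
    diameter-short : k ≤ 3 → 1 ≤ r ⊎ k ≡ 1 → IsDiameter bridged (2 + L)
    diameter-short k≤3 h = diameter (addEdge-walk? x≢y)
      (Walks.via-surface λ {i} {j} i≤j j≤L → inj₁
        (≤-trans (≤-reflexive (m≤n⇒∣m-n∣≡n∸m i≤j)) (≤-trans (m∸n≤m j i) j≤L)))
      (far h (1 ≤? r))
      where
      far : 1 ≤ r ⊎ k ≡ 1 → Dec (1 ≤ r) → Apart bridged (2 + L)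
      far _ (yes 1≤r) = subst (Apart bridged)
        (trans (override-off (>⇒≢ (FromLastFloor.Q<L 1≤r))) (cong (2 +_) (shortcut-useless k≤3)))
        (FromOrigin.apart-floor ≤-refl)
      far (inj₁ 1≤r) (no 1≰r) = contradiction 1≤r 1≰r
      far (inj₂ k≡1) (no 1≰r) = apart-mono 2+L≤3+M
        (subst (Apart bridged) (override-at Q (3 + M) _) (FromOrigin.apart-floor Q≤L))
        where
        open ≤-Reasoning
        2+L≤3+M : 2 + L ≤ 3 + M
        2+L≤3+M = begin
          2 + (M + k + r)  ≤⟨ +-monoʳ-≤ (2 + (M + k)) (≤-pred (≰⇒> 1≰r)) ⟩
          2 + (M + k) + 0  ≡⟨ cong (λ k → 2 + (M + k) + 0) k≡1 ⟩
          2 + (M + 1) + 0  ≡⟨ regroup M ⟩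
          3 + M            ∎
          where
          regroup : ∀ M → 2 + (M + 1) + 0 ≡ 3 + M
          regroup = solve-∀

-- Translation into the formulas in ord(ℓ).

-- With m = suc M, position i of the surface being the (i + 1)-st one, ord(ℓ) = 2 (m + k + r) + 1.
diameters : ∀ M k r {n} → n ≡ 1 + (suc M + k + r) * 2 → 1 ≤ k → (x y : Fin n) (x≢y : x ≢ y) →
    toℕ x ≡ 2 * suc M → toℕ y ≡ 2 * (suc M + k) →
    let m = suc M
        F+E = addEdge (folded n) x y x≢y
        Case₁ = 4 ≤ k
        Case₂ = (k ≡ 2 ⊎ k ≡ 3) × 2 * (m + k) ≡ n ∸ 1
    in
    (Case₁ → IsDiameter F+E
      (((n + 7) ∸ 2 * k) / 2
        ⊔ (⌈ k /2⌉ + ((n + 5) ∸ 2 * (m + k)) / 2)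
        ⊔ (m + ⌈ k /2⌉ + 2))) ×
    (Case₂ → IsDiameter F+E ((n ∸ 1) / 2)) ×
    (¬ Case₁ → ¬ Case₂ → IsDiameter F+E ((n + 1) / 2))
diameters M k r refl 1≤k x y x≢y x≡2m y≡2[m+k] =
  go (toℕ-injective (trans x≡2m (trans (*-comm 2 (suc M)) (sym (toℕ-floor M M≤L)))))
     (toℕ-injective (trans y≡2[m+k] (trans (*-comm 2 (suc Q)) (sym (toℕ-floor Q Q≤L)))))
  where
  open BridgedComponent M k r 1≤k
  n : ℕ
  n = order

  -- After the subtraction the dividend is a multiple of 2, so the division is exact.
  A≡ : ((n + 7) ∸ 2 * k) / 2 ≡ 2 + (M + (3 + r))
  A≡ = trans (cong (_/ 2) (trans (cong (_∸ 2 * k) (regroup M k r)) (m+n∸m≡n (2 * k) ((2 + (M + (3 + r))) * 2))))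
             (m*n/n≡m (2 + (M + (3 + r))) 2)
    where
    regroup : ∀ M k r → 3 + (M + k + r) * 2 + 7 ≡ 2 * k + (2 + (M + (3 + r))) * 2
    regroup = solve-∀

  B≡ : ⌈ k /2⌉ + ((n + 5) ∸ 2 * (suc M + k)) / 2 ≡ 2 + (⌈ k /2⌉ + suc r)
  B≡ = trans (cong (⌈ k /2⌉ +_) (trans (cong (_/ 2) (trans (cong (_∸ 2 * (suc M + k)) (regroup M k r))
                 (m+n∸m≡n (2 * (suc M + k)) ((3 + r) * 2)))) (m*n/n≡m (3 + r) 2)))
             (regroup′ ⌈ k /2⌉ r)
    where
    regroup : ∀ M k r → 3 + (M + k + r) * 2 + 5 ≡ 2 * (suc M + k) + (3 + r) * 2
    regroup = solve-∀
    regroup′ : ∀ c r → c + (3 + r) ≡ 2 + (c + suc r)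
    regroup′ = solve-∀

  C≡ : suc M + ⌈ k /2⌉ + 2 ≡ 2 + (M + suc ⌈ k /2⌉)
  C≡ = regroup M ⌈ k /2⌉
    where
    regroup : ∀ M c → suc M + c + 2 ≡ 2 + (M + suc c)
    regroup = solve-∀

  end⇒r≡0 : 2 * (suc M + k) ≡ n ∸ 1 → r ≡ 0
  end⇒r≡0 eq = +-cancelˡ-≡ (suc M + k) r 0 (trans
    (sym (*-cancelʳ-≡ (suc M + k) (suc M + k + r) 2 (trans (*-comm (suc M + k) 2) eq)))
    (sym (+-identityʳ (suc M + k))))

  go : x ≡ floor M M≤L → y ≡ floor Q Q≤L → _
  go refl refl =
    (λ 4≤k → subst (IsDiameter _) (sym (cong₂ _⊔_ (cong₂ _⊔_ A≡ B≡) C≡)) (diameter-long x≢y 4≤k)) ,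
    (λ { (k≡ , eq) → subst (IsDiameter _) (sym (m*n/n≡m (suc L) 2))
           (diameter-end x≢y (2≤ k≡) (≤3 k≡) (end⇒r≡0 eq)) }) ,
    λ k≱4 ¬end → subst (IsDiameter _) (sym (trans (cong (_/ 2) (+-comm n 1)) (m*n/n≡m (2 + L) 2)))
      (diameter-short x≢y (≤-pred (≰⇒> k≱4)) (away k 1≤k (≰⇒> k≱4) (1 ≤? r) λ { (k≡ , r≡0) → ¬end
        (k≡ , trans (*-comm 2 (suc Q)) (cong (_* 2) (sym (trans (cong (suc Q +_) r≡0) (+-identityʳ (suc Q)))))) }))
    where
    2≤ : k ≡ 2 ⊎ k ≡ 3 → 2 ≤ k
    2≤ (inj₁ refl) = ≤-refl
    2≤ (inj₂ refl) = s≤s (s≤s z≤n)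
    ≤3 : k ≡ 2 ⊎ k ≡ 3 → k ≤ 3
    ≤3 (inj₁ refl) = s≤s (s≤s z≤n)
    ≤3 (inj₂ refl) = ≤-refl
    away : ∀ k → 1 ≤ k → k < 4 → Dec (1 ≤ r) → ¬ ((k ≡ 2 ⊎ k ≡ 3) × r ≡ 0) → 1 ≤ r ⊎ k ≡ 1
    away _ _ _ (yes 1≤r) _ = inj₁ 1≤r
    away 1 _ _ (no _)    _ = inj₂ refl
    away 2 _ _ (no 1≰r) ¬end = contradiction (inj₁ refl , n≤0⇒n≡0 (≤-pred (≰⇒> 1≰r))) ¬end
    away 3 _ _ (no 1≰r) ¬end = contradiction (inj₂ refl , n≤0⇒n≡0 (≤-pred (≰⇒> 1≰r))) ¬end
    away (suc (suc (suc (suc _)))) _ (s≤s (s≤s (s≤s (s≤s ())))) _ _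

theorem36 : (n : ℕ) → n % 2 ≡ 1 → 3 < n →
    (x y : Fin n) → IsFloor x → IsFloor y → (x≢y : x ≢ y) →
    (m k : ℕ) → toℕ x ≡ 2 * m → toℕ y ≡ 2 * (m + k) →
    1 ≤ m → m ≤ (n ∸ 3) / 2 → 1 ≤ k → k ≤ (n ∸ 1) / 2 ∸ m →
    let F+E = addEdge (folded n) x y x≢y
        Case₁ = 4 ≤ k
        Case₂ = (k ≡ 2 ⊎ k ≡ 3) × 2 * (m + k) ≡ n ∸ 1
    in
    (Case₁ → IsDiameter F+E
      (((n + 7) ∸ 2 * k) / 2
        ⊔ (⌈ k /2⌉ + ((n + 5) ∸ 2 * (m + k)) / 2)
        ⊔ (m + ⌈ k /2⌉ + 2))) ×
    (Case₂ → IsDiameter F+E ((n ∸ 1) / 2)) ×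
    (¬ Case₁ → ¬ Case₂ → IsDiameter F+E ((n + 1) / 2))
theorem36 n n-odd _ x y _ _ x≢y (suc M) k x≡2m y≡2[m+k] _ _ 1≤k k≤h∸m =
  -- For odd `n` the half `h` is the number of floors, and `r` of them lie beyond the new edge.
  let r , m+k+r≡h = m≤n⇒∃[o]m+o≡n m+k≤h
  in diameters M k r (trans n≡1+2h (cong (λ h → 1 + h * 2) (sym m+k+r≡h))) 1≤k x y x≢y x≡2m y≡2[m+k]
  where
  h : ℕ
  h = n / 2
  n≡1+2h : n ≡ 1 + h * 2
  n≡1+2h = trans (m≡m%n+[m/n]*n n 2) (cong (_+ h * 2) n-odd)
  k≤h∸m′ : k ≤ h ∸ suc M
  k≤h∸m′ = subst (λ h → k ≤ h ∸ suc M) (trans (cong (λ n → (n ∸ 1) / 2) n≡1+2h) (m*n/n≡m h 2)) k≤h∸m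
  -- `h ∸ suc M` is at least `k`, hence positive, so the subtraction does not truncate.
  m≤h : suc M ≤ h
  m≤h = <⇒≤ (m∸n≢0⇒n<m (>⇒≢ (≤-trans 1≤k k≤h∸m′)))
  m+k≤h : suc M + k ≤ h
  m+k≤h = ≤-trans (+-monoʳ-≤ (suc M) k≤h∸m′) (≤-reflexive (m+[n∸m]≡n m≤h))
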